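{- For every integer $n > 9$ with $n \equiv 1 \pmod 4$, $DD_{\mathrm{m}}(P_3 \,\square\, P_n)=\gamma(P_3 \,\square\, P_n)+1$.
   Context: $P_k$ is the path on $k$ vertices and $\gamma(G)$ is the domination number of $G$. $G\,\square\,H$ denotes the Cartesian product: vertex set $V(G)\times V(H)$, with $(a,b)$ and $(c,d)$ adjacent iff $a=c$ and $bd\in E(H)$, or $ac\in E(G)$ and $b=d$. Swap number: a dominating set $D$ of a graph $G$ is a swap set if there is a dominating set $D'$ of $G$ with $D\cap D'=\emptyset$, $|D|=|D'|$, such that $G$ contains a perfect matching between $D$ and $D'$ (a bijection $f:D\to D'$ with $x f(x)\in E(G)$ for all $x\in D$). $DD_{\mathrm{m}}(G)$ is the minimum cardinality of a swap set of $G$, and $DD_{\mathrm{m}}(G)=\infty$ if none exists. -}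

module Defs where

open import Data.Fin using (Fin; toℕ; remQuot)
open import Data.Fin.Properties using (any?; all?)
  renaming (_≟_ to _≟ᶠ_)
open import Data.Fin.Subset using (Subset; _∈_; _∩_; Empty; ∣_∣; ⊤)
open import Data.Fin.Subset.Properties using (_∈?_; anySubset?; nonempty?; ∈⊤; ∣p∣≤n)
open import Data.Nat using (ℕ; zero; suc; _*_; _≤_; _≟_; z≤n)
open import Data.Nat.Properties using (1+n≢n; ≤-trans; ≤∧≢⇒<; 1+n≰n)
open import Data.Product using (Σ; ∃; ∃-syntax; _×_; _,_; proj₁; proj₂)
open import Data.Sum using (_⊎_; inj₁; inj₂; swap)
open import Data.Vec using (Vec; []; _∷_; lookup; tabulate)
open import Data.Vec.Properties using (lookup∘tabulate)
open import Data.Vec.Properties.WithK using ([]=-irrelevant)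
open import Function using (_∘_)
open import Function.Bundles using (_⤖_; mk⤖; module Bijection)
open import Level using (0ℓ)
open import Relation.Binary using (Rel; Symmetric; Irreflexive)
  renaming (Decidable to Decidable₂)
open import Relation.Binary.PropositionalEquality using (_≡_; refl; sym; trans; cong; subst)
open import Relation.Nullary using (¬_; Dec; yes; no; contradiction)
open import Relation.Nullary.Construct.Add.Supremum using (_⁺; ⊤⁺; [_])
open import Relation.Nullary.Decidable using (map′; _×-dec_; _⊎-dec_; _→-dec_; ¬?)
open import Relation.Unary using (Pred; Decidable)

-- Finite simple graphs, with vertex set Fin order.
record Graph : Set₁ where
  field
    order  : ℕ
    Adj    : Rel (Fin order) 0ℓ
    symm   : Symmetric Adj
    irrefl : Irreflexive _≡_ Adj
    adj?   : Decidable₂ Adj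

P : ℕ → Graph
P k = record
  { order  = k
  ; Adj    = λ i j → toℕ j ≡ suc (toℕ i) ⊎ toℕ i ≡ suc (toℕ j)
  ; symm   = swap
  ; irrefl = λ { refl (inj₁ e) → 1+n≢n (sym e) ; refl (inj₂ e) → 1+n≢n (sym e) }
  ; adj?   = λ i j → (toℕ j ≟ suc (toℕ i)) ⊎-dec (toℕ i ≟ suc (toℕ j))
  }

-- Cartesian product.  V(G) × V(H) is encoded as Fin (order G * order H)
-- through the bijection remQuot, whose inverse is combine.
infixl 7 _□_

_□_ : Graph → Graph → Graph
G □ H = record
  { order  = G.order * H.order
  ; Adj    = λ x y → Adj× (remQuot H.order x) (remQuot H.order y)
  ; symm   = λ { (inj₁ (e , a)) → inj₁ (sym e , H.symm a)
               ; (inj₂ (a , e)) → inj₂ (G.symm a , sym e) }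
  ; irrefl = λ { refl (inj₁ (_ , a)) → H.irrefl refl a
               ; refl (inj₂ (a , _)) → G.irrefl refl a }
  ; adj?   = λ x y → adj×? (remQuot H.order x) (remQuot H.order y)
  }
  where
  module G = Graph G
  module H = Graph H

  Adj× : Rel (Fin G.order × Fin H.order) 0ℓ
  Adj× (a , b) (c , d) = (a ≡ c × H.Adj b d) ⊎ (G.Adj a c × b ≡ d)

  adj×? : Decidable₂ Adj×
  adj×? (a , b) (c , d) =
    ((a ≟ᶠ c) ×-dec H.adj? b d) ⊎-dec (G.adj? a c ×-dec (b ≟ᶠ d))

module _ (G : Graph) where
  open Graph G

  Dominating : Pred (Subset order) 0ℓ
  Dominating D = ∀ v → v ∈ D ⊎ ∃[ u ] (u ∈ D × Adj u v)

  PerfectMatching : Rel (Subset order) 0ℓ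
  PerfectMatching D D′ =
    Σ (∃ (_∈ D) ⤖ ∃ (_∈ D′)) λ f → ∀ x → Adj (proj₁ x) (proj₁ (Bijection.to f x))

  SwapSet : Pred (Subset order) 0ℓ
  SwapSet D = Dominating D × ∃[ D′ ]
    (Dominating D′ × Empty (D ∩ D′) × ∣ D ∣ ≡ ∣ D′ ∣ × PerfectMatching D D′)

  dominating? : Decidable Dominating
  dominating? D = all? λ v → (v ∈? D) ⊎-dec any? λ u → (u ∈? D) ×-dec adj? u v

anyVec? : ∀ {m n} {Q : Pred (Vec (Fin m) n) 0ℓ} → Decidable Q → Dec (∃ Q)
anyVec? {n = zero}  Q? = map′ ([] ,_) (λ { ([] , q) → q }) (Q? [])
anyVec? {n = suc n} Q? = map′
  (λ { (x , xs , q) → x ∷ xs , q })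
  (λ { (x ∷ xs , q) → x , xs , q })
  (any? λ x → anyVec? (Q? ∘ (x ∷_)))

module _ (G : Graph) where
  open Graph G

  private
    -- PerfectMatching in terms of an arbitrary extension of the bijection to
    -- all vertices; only used to decide PerfectMatching by finite search.
    Matches : Subset order → Subset order → (Fin order → Fin order) → Set
    Matches D D′ g =
      (∀ x → x ∈ D → g x ∈ D′ × Adj x (g x)) ×
      (∀ x y → x ∈ D → y ∈ D → g x ≡ g y → x ≡ y) ×
      (∀ y → y ∈ D′ → ∃[ x ] (x ∈ D × g x ≡ y))

    matches? : ∀ D D′ → Decidable (Matches D D′)
    matches? D D′ g =
      (all? λ x → (x ∈? D) →-dec ((g x ∈? D′) ×-dec adj? x (g x))) ×-dec
      (all? λ x → all? λ y →
        (x ∈? D) →-dec ((y ∈? D) →-dec ((g x ≟ᶠ g y) →-dec (x ≟ᶠ y)))) ×-dec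
      (all? λ y → (y ∈? D′) →-dec any? λ x → (x ∈? D) ×-dec (g x ≟ᶠ y))

    ∃∈-≡ : ∀ {D : Subset order} {x y : ∃ (_∈ D)} → proj₁ x ≡ proj₁ y → x ≡ y
    ∃∈-≡ {x = a , p} {y = .a , q} refl = cong (a ,_) ([]=-irrelevant p q)

    restrict : ∀ {D D′ g} → Matches D D′ g → PerfectMatching G D D′
    restrict {D} {D′} {g} (m , inj , surj) =
      mk⤖ {to = to}
        ( (λ {x} {y} e → ∃∈-≡ (inj (proj₁ x) (proj₁ y) (proj₂ x) (proj₂ y) (cong proj₁ e)))
        , (λ (y , y∈) → let (x , x∈ , e) = surj y y∈ in
             (x , x∈) , λ { refl → ∃∈-≡ e }) )
      , λ (x , x∈) → proj₂ (m x x∈)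
      where
      to : ∃ (_∈ D) → ∃ (_∈ D′)
      to (x , x∈) = g x , proj₁ (m x x∈)

    extend : ∀ {D D′} → PerfectMatching G D D′ →
             ∃[ v ] Matches D D′ (lookup {n = order} v)
    extend {D} {D′} (f , adj) = tabulate g
      , (λ x x∈ → subst (λ z → z ∈ D′ × Adj x z) (sym (eq x x∈))
                    (proj₂ (f.to (x , x∈)) , adj (x , x∈)))
      , (λ x y x∈ y∈ e → cong proj₁ (f.injective
           (∃∈-≡ (trans (sym (eq x x∈)) (trans e (eq y y∈))))))
      , (λ y y∈ → let ((x , x∈) , e) = f.strictlySurjective (y , y∈) in
           x , x∈ , trans (eq x x∈) (cong proj₁ e))
      where
      module f = Bijection f

      g : Fin order → Fin order
      g x with x ∈? D
      ... | yes x∈ = proj₁ (f.to (x , x∈))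
      ... | no  _  = x

      g-∈ : ∀ x (x∈ : x ∈ D) → g x ≡ proj₁ (f.to (x , x∈))
      g-∈ x x∈ with x ∈? D
      ... | yes p  = cong (λ q → proj₁ (f.to (x , q))) ([]=-irrelevant p x∈)
      ... | no  x∉ = contradiction x∈ x∉

      eq : ∀ x (x∈ : x ∈ D) → lookup (tabulate g) x ≡ proj₁ (f.to (x , x∈))
      eq x x∈ = trans (lookup∘tabulate g x) (g-∈ x x∈)

  perfectMatching? : Decidable₂ (PerfectMatching G)
  perfectMatching? D D′ =
    map′ (λ (_ , m) → restrict m) extend (anyVec? (matches? D D′ ∘ lookup))

  swapSet? : Decidable (SwapSet G)
  swapSet? D = dominating? G D ×-dec anySubset? λ D′ →
    dominating? G D′ ×-dec ¬? (nonempty? (D ∩ D′)) ×-dec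
    (∣ D ∣ ≟ ∣ D′ ∣) ×-dec perfectMatching? D D′

IsMinCard : ∀ {n} → Pred (Subset n) 0ℓ → ℕ → Set
IsMinCard Q k = (∃[ p ] (Q p × ∣ p ∣ ≡ k)) × (∀ p → Q p → k ≤ ∣ p ∣)

minCard : ∀ {n} {Q : Pred (Subset n) 0ℓ} → Decidable Q →
          ∃ (IsMinCard Q) ⊎ (∀ p → ¬ Q p)
minCard {n} {Q} Q? with search (suc n)
  where
  search : ∀ m → ∃ (IsMinCard Q) ⊎ (∀ p → Q p → m ≤ ∣ p ∣)
  search zero = inj₂ λ _ _ → z≤n
  search (suc m) with search m
  ... | inj₁ found = inj₁ found
  ... | inj₂ m≤ with anySubset? (λ p → Q? p ×-dec (∣ p ∣ ≟ m))
  ...   | yes ex = inj₁ (m , ex , m≤)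
  ...   | no ¬ex = inj₂ λ p q → ≤∧≢⇒< (m≤ p q) λ m≡ → ¬ex (p , q , sym m≡)
... | inj₁ found = inj₁ found
... | inj₂ n<    = inj₂ λ p q → 1+n≰n (≤-trans (n< p q) (∣p∣≤n p))

dominationNumber : ∀ G → ∃ (IsMinCard (Dominating G))
dominationNumber G with minCard (dominating? G)
... | inj₁ found = found
... | inj₂ none  = contradiction (λ _ → inj₁ ∈⊤) (none ⊤)

γ : Graph → ℕ
γ G = proj₁ (dominationNumber G)

-- [ k ] is the finite value k and ⊤⁺ is ∞.
DDₘ : Graph → ℕ ⁺
DDₘ G with minCard (swapSet? G)
... | inj₁ (k , _) = [ k ]
... | inj₂ _       = ⊤⁺

{-# OPTIONS --safe #-}
module Submission where

-- For n = 4m + 1 a potential argument along the columns gives 4 ∣D∣ ≥ 3n + 1 for every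
-- dominating set D, and 4 ∣D∣ ≥ 3n + 2 if D omits the middle vertex of the first column.  Hence
-- γ = 3m + 1, attained by alternating {middle}, ∅, {top, bottom}, ∅, …; two disjoint dominating
-- sets cannot both contain that vertex, so a swap set has at least 3m + 2 elements.  A swap set
-- of this size is a periodic word of labelled columns, in which domination and the matching
-- only involve three consecutive columns.

open import Defs
open import Data.Nat using (ℕ; _+_; _>_; _%_)
open import Relation.Binary.PropositionalEquality using (_≡_)
open import Relation.Nullary.Construct.Add.Supremum using ([_])

open import Data.Bool using (Bool; true; false; not; if_then_else_)
import Data.Bool.Properties as Bool
open import Data.Fin using (Fin; zero; suc; toℕ; inject₁; combine; remQuot)
open import Data.Fin.Patterns using (0F; 1F; 2F)
open import Data.Fin.Properties using (all?; any?; toℕ-injective; toℕ-inject₁; combine-remQuot; remQuot-combine)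
import Data.Fin.Properties as Fin
open import Data.Fin.Subset using (Subset; _∈_; ∣_∣; ⊥)
open import Data.Fin.Subset.Properties using (_∈?_; anySubset?; ∉⊥; x∈p∩q⁺; x∈p∩q⁻)
open import Data.Maybe using (Maybe; just; nothing)
import Data.Maybe.Properties as Maybe
open import Data.Nat using (zero; suc; _*_; _∸_; _/_; _≤_; _<_; s≤s; _≤?_)
open import Data.Nat.DivMod using (m≡m%n+[m/n]*n)
open import Data.Nat.Properties using (≤-antisym; ≤-trans; ≤-reflexive; <⇒≤; suc-injective; +-comm; m≤m+n; +-cancelʳ-≤; +-mono-≤; *-cancelˡ-≤; *-cancelˡ-<; module ≤-Reasoning)
open import Data.Nat.Tactic.RingSolver using (solve-∀)
open import Data.Product using (∃; ∃-syntax; _×_; _,_; proj₁; proj₂; uncurry)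
open import Data.Product.Properties using () renaming (≡-dec to ×-≡-dec)
open import Data.Sum using (_⊎_; inj₁; inj₂; map₂)
open import Data.Sum.Properties using () renaming (≡-dec to ⊎-≡-dec)
open import Data.Unit using (⊤; tt)
open import Data.Vec using (Vec; []; _∷_; _++_; _∷ʳ_; lookup; tabulate; map; concat; replicate; sum)
open import Data.Vec.Properties using (lookup∘tabulate; tabulate∘lookup; tabulate-cong; lookup-concat; lookup-map; []=⇒lookup; lookup⇒[]=)
open import Data.Vec.Properties.WithK using ([]=-irrelevant)
open import Function using (_∘_)
open import Function.Bundles using (mk⤖)
open import Level using (0ℓ)
open import Relation.Binary.PropositionalEquality using (_≢_; refl; sym; trans; cong; cong₂; subst; subst₂)
open import Relation.Nullary using (¬_; Dec; yes; does; contradiction)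
open import Relation.Nullary.Decidable using (map′; ¬?; _⊎-dec_; _×-dec_; _→-dec_; decidable-stable; from-yes)
open import Relation.Unary using (Pred; Decidable)

private
  variable
    A B : Set
    k n : ℕ

-- Minimum cardinalities and search over subsets

IsMinCard-unique : ∀ {Q : Pred (Subset n) 0ℓ} {k l} → IsMinCard Q k → IsMinCard Q l → k ≡ l
IsMinCard-unique ((p , Qp , refl) , k≤) ((q , Qq , refl) , l≤) = ≤-antisym (k≤ q Qq) (l≤ p Qp)

γ≡ : ∀ G {k} → IsMinCard (Dominating G) k → γ G ≡ k
γ≡ G = IsMinCard-unique (proj₂ (dominationNumber G))

-- `DDₘ` is the outcome of an exhaustive search. Its value is read off from the uniqueness of the
-- minimum without running the search; a witness rules out ∞.
DDₘ≡ : ∀ G {k} → IsMinCard (SwapSet G) k → DDₘ G ≡ [ k ]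
DDₘ≡ G min with minCard (swapSet? G)
... | inj₁ (_ , min′) = cong [_] (IsMinCard-unique min′ min)
... | inj₂ none with (p , swap , _) , _ ← min = contradiction swap (none p)

-- Turns the inequalities about all columns below into finite checks that `from-yes` evaluates.
allSubset? : {Q : Pred (Subset n) 0ℓ} → Decidable Q → Dec (∀ p → Q p)
allSubset? Q? = map′
  (λ ∄¬ p → decidable-stable (Q? p) λ ¬q → ∄¬ (p , ¬q))
  (λ ∀q (p , ¬q) → ¬q (∀q p))
  (¬? (anySubset? (¬? ∘ Q?)))

-- Consecutive triples

-- `e` stands for the letter just beyond either end of the word, so that border columns are treated
-- like inner ones.
prev next : A → Vec A n → Fin n → A
prev e w j = lookup (e ∷ w) (inject₁ j)
next e w j = lookup (w ∷ʳ e) (suc j)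

prev-≡ : ∀ (e : A) (w : Vec A n) {j j′} → toℕ j ≡ suc (toℕ j′) → prev e w j ≡ lookup w j′
prev-≡ e w {suc j} eq =
  cong (lookup w) (toℕ-injective (trans (toℕ-inject₁ j) (suc-injective eq)))

next-≡ : ∀ (e : A) (w : Vec A n) {j j′} → toℕ j′ ≡ suc (toℕ j) → next e w j ≡ lookup w j′
next-≡ e (x ∷ y ∷ w) {zero}  {suc zero} eq = refl
next-≡ e (x ∷ w)     {suc j} {suc j′}   eq = next-≡ e w (suc-injective eq)

prev-view : ∀ (e : A) (w : Vec A n) j →
            prev e w j ≡ e ⊎ ∃[ j′ ] (toℕ j ≡ suc (toℕ j′) × prev e w j ≡ lookup w j′)
prev-view e w zero    = inj₁ refl
prev-view e w (suc j) = inj₂ (inject₁ j , cong suc (sym (toℕ-inject₁ j)) , refl)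

next-view : ∀ (e : A) (w : Vec A n) j →
            next e w j ≡ e ⊎ ∃[ j′ ] (toℕ j′ ≡ suc (toℕ j) × next e w j ≡ lookup w j′)
next-view e (x ∷ [])    zero    = inj₁ refl
next-view e (x ∷ y ∷ w) zero    = inj₂ (1F , refl , refl)
next-view e (x ∷ w)     (suc j) =
  map₂ (λ (j′ , eq , eq′) → suc j′ , cong suc eq , eq′) (next-view e w j)

-- R holds of all triples of consecutive letters of the word l w r.
data Windows (R : A → A → A → Set) (l r : A) : Vec A n → Set where
  []  : Windows R l r []
  _∷_ : ∀ {x} {w : Vec A n} →
        R l x (lookup (w ∷ʳ r) zero) → Windows R x r w → Windows R l r (x ∷ w)

module _ {R : A → A → A → Set} {r : A} where

  -- `Windows` suits explicit words and induction, the indexed form suits single vertices; `window`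
  -- and `windows` translate between them.
  window : ∀ {l} {w : Vec A n} → Windows R l r w → ∀ j → R (prev l w j) (lookup w j) (next r w j)
  window (t ∷ ts) zero    = t
  window (t ∷ ts) (suc j) = window ts j

  windows : ∀ {l} {w : Vec A n} → (∀ j → R (prev l w j) (lookup w j) (next r w j)) → Windows R l r w
  windows {w = []}    ts = []
  windows {w = x ∷ w} ts = ts zero ∷ windows (ts ∘ suc)

windows-map : ∀ {R : A → A → A → Set} {S : B → B → B → Set} (f : A → B) →
              (∀ {a b c} → R a b c → S (f a) (f b) (f c)) →
              ∀ {l r} {w : Vec A n} → Windows R l r w → Windows S (f l) (f r) (map f w)
windows-map f R⇒S []                       = []
-- The split decides whether the letter after the first one is the border `r` or the second letter
-- of the word.
windows-map f R⇒S {w = _ ∷ []}    (t ∷ ts) = R⇒S t ∷ windows-map f R⇒S ts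
windows-map f R⇒S {w = _ ∷ _ ∷ _} (t ∷ ts) = R⇒S t ∷ windows-map f R⇒S ts

-- The grid by columns

rowOf : Fin 3 → Vec (Subset 3) n → Subset n
rowOf i = map λ c → lookup c i

∣++∣ : ∀ (p : Subset k) (q : Subset n) → ∣ p ++ q ∣ ≡ ∣ p ∣ + ∣ q ∣
∣++∣ []          q = refl
∣++∣ (true ∷ p)  q = cong suc (∣++∣ p q)
∣++∣ (false ∷ p) q = ∣++∣ p q

opaque
  -- Concatenates rows because `combine i j` numbers the cells of the grid row by row. Opaque, so
  -- that from here on only its size and its entries are used.
  fill : Vec (Subset 3) n → Subset (3 * n)
  fill w = concat (tabulate λ i → rowOf i w)

  ∣fill∣-rows : ∀ (w : Vec (Subset 3) n) →
                ∣ fill w ∣ ≡ ∣ rowOf 0F w ∣ + (∣ rowOf 1F w ∣ + (∣ rowOf 2F w ∣ + 0))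
  ∣fill∣-rows w = trans (∣++∣ (rowOf 0F w) _) (cong (∣ rowOf 0F w ∣ +_)
    (trans (∣++∣ (rowOf 1F w) _) (cong (∣ rowOf 1F w ∣ +_) (∣++∣ (rowOf 2F w) []))))

  lookup-fill-combine : ∀ (w : Vec (Subset 3) n) i j →
                        lookup (fill w) (combine i j) ≡ lookup (lookup w j) i
  lookup-fill-combine w i j = trans (lookup-concat (tabulate λ i → rowOf i w) i j)
    (trans (cong (λ r → lookup r j) (lookup∘tabulate (λ i → rowOf i w) i)) (lookup-map j _ w))

total : Vec (Subset 3) n → ℕ
total w = sum (map ∣_∣ w)

∣fill∣ : ∀ (w : Vec (Subset 3) n) → ∣ fill w ∣ ≡ total w
∣fill∣ w = trans (∣fill∣-rows w) (sumRows w)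
  where
  regroup : ∀ x y z p q r → (x + p) + ((y + q) + ((z + r) + 0)) ≡ (x + (y + z)) + (p + (q + (r + 0)))
  regroup = solve-∀

  head : ∀ b (p : Subset n) → ∣ b ∷ p ∣ ≡ ∣ b ∷ [] ∣ + ∣ p ∣
  head b p = ∣++∣ (b ∷ []) p

  sumRows : ∀ (w : Vec (Subset 3) n) →
            ∣ rowOf 0F w ∣ + (∣ rowOf 1F w ∣ + (∣ rowOf 2F w ∣ + 0)) ≡ total w
  sumRows [] = refl
  sumRows ((x ∷ y ∷ z ∷ []) ∷ w) =
    trans (cong₂ _+_ (head x r₀) (cong₂ _+_ (head y r₁) (cong (_+ 0) (head z r₂))))
    (trans (regroup (∣ x ∷ [] ∣) (∣ y ∷ [] ∣) (∣ z ∷ [] ∣) (∣ r₀ ∣) (∣ r₁ ∣) (∣ r₂ ∣))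
    (cong₂ _+_
      (sym (trans (head x (y ∷ z ∷ [])) (cong (∣ x ∷ [] ∣ +_) (head y (z ∷ [])))))
      (sumRows w)))
    where
    r₀ = rowOf 0F w
    r₁ = rowOf 1F w
    r₂ = rowOf 2F w

-- Domination by columns

-- The next column is left out on purpose: reading from left to right, a vertex of `b` not covered
-- in this sense is a debt that the next column has to pay.
Covered : Subset 3 → Subset 3 → Fin 3 → Set
Covered a b i = i ∈ b ⊎ ∃[ i′ ] (i′ ∈ b × Graph.Adj (P 3) i′ i) ⊎ i ∈ a

covered? : ∀ a b → Decidable (Covered a b)
covered? a b i =
  (i ∈? b) ⊎-dec any? (λ i′ → (i′ ∈? b) ×-dec Graph.adj? (P 3) i′ i) ⊎-dec (i ∈? a)

DominatedBetween : Subset 3 → Subset 3 → Subset 3 → Set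
DominatedBetween a b c = ∀ i → Covered a b i ⊎ i ∈ c

dominatedBetween? : ∀ a b c → Dec (DominatedBetween a b c)
dominatedBetween? a b c = all? λ i → covered? a b i ⊎-dec (i ∈? c)

module Grid (n : ℕ) where

  G : Graph
  G = P 3 □ P n

  open Graph G using (Adj)

  V : Set
  V = Fin 3 × Fin n

  coords : Fin (3 * n) → V
  coords = remQuot n

  vertex : V → Fin (3 * n)
  vertex = uncurry combine

  coords-vertex : ∀ v → coords (vertex v) ≡ v
  coords-vertex (i , j) = remQuot-combine i j

  coords-injective : ∀ {x y} → coords x ≡ coords y → x ≡ y
  coords-injective {x} {y} eq =
    trans (sym (combine-remQuot {3} n x)) (trans (cong vertex eq) (combine-remQuot {3} n y))

  _~_ : V → V → Set
  (i , j) ~ (i′ , j′) = (i ≡ i′ × Graph.Adj (P n) j j′) ⊎ (Graph.Adj (P 3) i i′ × j ≡ j′)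

  _at_ : Vec (Vec A 3) n → V → A
  w at (i , j) = lookup (lookup w j) i

  lookup-fill : ∀ w x → lookup (fill w) x ≡ w at coords x
  lookup-fill w x =
    trans (cong (lookup (fill w)) (sym (combine-remQuot {3} n x))) (lookup-fill-combine w _ _)

  ∈-fill⁺ : ∀ w x → w at coords x ≡ true → x ∈ fill w
  ∈-fill⁺ w x eq = lookup⇒[]= x (fill w) (trans (lookup-fill w x) eq)

  vertex-∈-fill : ∀ w v → w at v ≡ true → vertex v ∈ fill w
  vertex-∈-fill w v eq = ∈-fill⁺ w (vertex v) (trans (cong (w at_) (coords-vertex v)) eq)

  ∈-fill⁻ : ∀ w x → x ∈ fill w → w at coords x ≡ true
  ∈-fill⁻ w x m = trans (sym (lookup-fill w x)) ([]=⇒lookup m)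

  columns : Subset (3 * n) → Vec (Subset 3) n
  columns D = tabulate λ j → tabulate λ i → lookup D (combine i j)

  -- Transfers bounds proved for words of columns to arbitrary vertex sets.
  fill-columns : ∀ D → fill (columns D) ≡ D
  fill-columns D =
    trans (sym (tabulate∘lookup _)) (trans (tabulate-cong pointwise) (tabulate∘lookup D))
    where
    columns-at : ∀ v → columns D at v ≡ lookup D (vertex v)
    columns-at (i , j) = trans
      (cong (λ c → lookup c i) (lookup∘tabulate (λ j → tabulate λ i → lookup D (combine i j)) j))
      (lookup∘tabulate (λ i → lookup D (combine i j)) i)

    pointwise : ∀ x → lookup (fill (columns D)) x ≡ lookup D x
    pointwise x = trans (lookup-fill (columns D) x)
      (trans (columns-at (coords x)) (cong (lookup D) (combine-remQuot {3} n x)))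

  dominating⁺ : ∀ w → Windows DominatedBetween ⊥ ⊥ w → Dominating G (fill w)
  dominating⁺ w dom x = at (coords x) refl (window dom _ _)
    where
    neighbour : ∀ v → w at v ≡ true → v ~ coords x → ∃[ u ] (u ∈ fill w × Adj u x)
    neighbour v eq a = vertex v
      , vertex-∈-fill w v eq
      , subst (_~ coords x) (sym (coords-vertex v)) a

    at : ∀ v → v ≡ coords x → let (i , j) = v in
         Covered (prev ⊥ w j) (lookup w j) i ⊎ i ∈ next ⊥ w j →
         x ∈ fill w ⊎ ∃[ u ] (u ∈ fill w × Adj u x)
    at v eq (inj₁ (inj₁ m)) = inj₁ (∈-fill⁺ w x (trans (cong (w at_) (sym eq)) ([]=⇒lookup m)))
    at (i , j) eq (inj₁ (inj₂ (inj₁ (i′ , m , a)))) =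
      inj₂ (neighbour (i′ , j) ([]=⇒lookup m) (subst (_ ~_) eq (inj₂ (a , refl))))
    at (i , j) eq (inj₁ (inj₂ (inj₂ m))) with prev-view ⊥ w j
    -- The column beyond the border is `⊥`, so it dominates nothing.
    ... | inj₁ e            = contradiction (subst (i ∈_) e m) ∉⊥
    ... | inj₂ (j′ , s , e) = inj₂ (neighbour (i , j′) ([]=⇒lookup (subst (i ∈_) e m))
                                (subst (_ ~_) eq (inj₁ (refl , inj₁ s))))
    at (i , j) eq (inj₂ m) with next-view ⊥ w j
    ... | inj₁ e            = contradiction (subst (i ∈_) e m) ∉⊥
    ... | inj₂ (j′ , s , e) = inj₂ (neighbour (i , j′) ([]=⇒lookup (subst (i ∈_) e m))
                                (subst (_ ~_) eq (inj₁ (refl , inj₂ s))))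

  dominating⁻ : ∀ w → Dominating G (fill w) → Windows DominatedBetween ⊥ ⊥ w
  dominating⁻ w dom = windows λ j i → column j i (dom (vertex (i , j)))
    where
    at : ∀ v {i j} → proj₁ v ∈ lookup w (proj₂ v) → v ~ (i , j) →
         Covered (prev ⊥ w j) (lookup w j) i ⊎ i ∈ next ⊥ w j
    at _ m (inj₁ (refl , inj₁ s)) = inj₁ (inj₂ (inj₂ (subst (_ ∈_) (sym (prev-≡ ⊥ w s)) m)))
    at _ m (inj₁ (refl , inj₂ s)) = inj₂ (subst (_ ∈_) (sym (next-≡ ⊥ w s)) m)
    at _ m (inj₂ (a , refl))      = inj₁ (inj₂ (inj₁ (_ , m , a)))

    column : ∀ j i → vertex (i , j) ∈ fill w ⊎ ∃[ u ] (u ∈ fill w × Adj u (vertex (i , j))) →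
             Covered (prev ⊥ w j) (lookup w j) i ⊎ i ∈ next ⊥ w j
    column j i (inj₁ m) = inj₁ (inj₁ (lookup⇒[]= i _
      (trans (cong (w at_) (sym (coords-vertex (i , j)))) (∈-fill⁻ w _ m))))
    column j i (inj₂ (u , m , a)) = at (coords u) (lookup⇒[]= _ _ (∈-fill⁻ w u m))
      (subst (coords u ~_) (coords-vertex (i , j)) a)

-- The lower bound

exposed : Subset 3 → Subset 3 → Subset 3
exposed a b = tabulate λ i → not (does (covered? a b i))

-- The potential of two consecutive columns a, b is demand a b − surplus b, kept in ℕ by moving
-- the surplus to the other side of each inequality.
demand : Subset 3 → Subset 3 → ℕ
demand a b = 2 * ∣ exposed a b ∣ ∸ 1

surplus : Subset 3 → ℕ
surplus b = 2 * (∣ b ∣ ∸ 1)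

-- With the potential φ = demand - surplus this reads 3 + φ(a, b) ≤ 4∣c∣ + φ(b, c), checked on all
-- 512 triples. Equality holds all along the pattern {middle}, ∅, {top, bottom}, ∅, which explains
-- the weights in φ.
potential-step : ∀ a b c → DominatedBetween a b c →
                 3 + demand a b + surplus c ≤ 4 * ∣ c ∣ + demand b c + surplus b
potential-step = from-yes (allSubset? λ a → allSubset? λ b → allSubset? λ c →
  dominatedBetween? a b c →-dec
  (3 + demand a b + surplus c ≤? 4 * ∣ c ∣ + demand b c + surplus b))

-- Nothing follows `b`, so none of its vertices is exposed and the truncated `demand` is 0.
potential-end : ∀ a b → DominatedBetween a b ⊥ → demand a b ≤ surplus b
potential-end = from-yes (allSubset? λ a → allSubset? λ b →
  dominatedBetween? a b ⊥ →-dec (demand a b ≤? surplus b))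

missing : Subset 3 → ℕ
missing c = if lookup c 1F then 0 else 1

missing-view : ∀ c → lookup c 1F ≡ true ⊎ missing c ≡ 1
missing-view (_ ∷ true ∷ _)  = inj₁ refl
missing-view (_ ∷ false ∷ _) = inj₂ refl

-- The constant is 4 where `potential-step` has 3: this is the extra 1 in 3n + 1. The term
-- `missing c` is the further unit gained when the middle vertex is absent.
potential-start : ∀ c → 4 + missing c + surplus c ≤ 4 * ∣ c ∣ + demand ⊥ c
potential-start = from-yes (allSubset? λ c →
  4 + missing c + surplus c ≤? 4 * ∣ c ∣ + demand ⊥ c)

-- `potential-step` telescopes over the `k` columns after `b`, and `potential-end` closes the sum.
potential-bound : ∀ a b (w : Vec (Subset 3) k) → Windows DominatedBetween a ⊥ (b ∷ w) →
                  3 * k + demand a b ≤ 4 * total w + surplus b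
potential-bound a b [] (t ∷ []) = potential-end a b t
-- Telescoping without subtraction: both parts of the inner potential are added to the two sides and
-- then cancelled.
potential-bound {suc k} a b (c ∷ w) (t ∷ ts) = +-cancelʳ-≤ (demand b c + surplus c) _ _ (begin
  3 * suc k + demand a b + (demand b c + surplus c)
    ≡⟨ lhs k (demand a b) (demand b c) (surplus c) ⟩
  (3 + demand a b + surplus c) + (3 * k + demand b c)
    ≤⟨ +-mono-≤ (potential-step a b c t) (potential-bound b c w ts) ⟩
  (4 * ∣ c ∣ + demand b c + surplus b) + (4 * total w + surplus c)
    ≡⟨ rhs (∣ c ∣) (total w) (demand b c) (surplus b) (surplus c) ⟩
  4 * (∣ c ∣ + total w) + surplus b + (demand b c + surplus c) ∎)
  where
  open ≤-Reasoning
  lhs : ∀ k d d′ s → 3 * suc k + d + (d′ + s) ≡ (3 + d + s) + (3 * k + d′)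
  lhs = solve-∀
  rhs : ∀ x t d s s′ → (4 * x + d + s) + (4 * t + s′) ≡ 4 * (x + t) + s + (d + s′)
  rhs = solve-∀

column-bound : ∀ c (w : Vec (Subset 3) k) → Windows DominatedBetween ⊥ ⊥ (c ∷ w) →
               4 + 3 * k + missing c ≤ 4 * total (c ∷ w)
column-bound {k} c w dom = +-cancelʳ-≤ (surplus c + demand ⊥ c) _ _ (begin
  4 + 3 * k + missing c + (surplus c + demand ⊥ c)
    ≡⟨ lhs k (missing c) (surplus c) (demand ⊥ c) ⟩
  (4 + missing c + surplus c) + (3 * k + demand ⊥ c)
    ≤⟨ +-mono-≤ (potential-start c) (potential-bound ⊥ c w dom) ⟩
  (4 * ∣ c ∣ + demand ⊥ c) + (4 * total w + surplus c)
    ≡⟨ rhs (∣ c ∣) (total w) (surplus c) (demand ⊥ c) ⟩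
  4 * (∣ c ∣ + total w) + (surplus c + demand ⊥ c) ∎)
  where
  open ≤-Reasoning
  lhs : ∀ k m s d → 4 + 3 * k + m + (s + d) ≡ (4 + m + s) + (3 * k + d)
  lhs = solve-∀
  rhs : ∀ x t s d → (4 * x + d) + (4 * t + s) ≡ 4 * (x + t) + (s + d)
  rhs = solve-∀

module _ (m : ℕ) where
  open Grid (1 + m * 4)

  private
    -- For n = 4m + 1 the bound 3n + 1 is exactly a multiple of 4, so one more unit forces one more
    -- element.
    scale : 4 + 3 * (m * 4) ≡ 4 * (1 + m * 3)
    scale = lemma m
      where
      lemma : ∀ m → 4 + 3 * (m * 4) ≡ 4 * (1 + m * 3)
      lemma = solve-∀

    Bound : Subset (3 * (1 + m * 4)) → Set
    Bound D = 1 + m * 3 ≤ ∣ D ∣ × (vertex (1F , zero) ∈ D ⊎ 2 + m * 3 ≤ ∣ D ∣)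

    fill-bound : ∀ (w : Vec (Subset 3) (1 + m * 4)) → Dominating G (fill w) → Bound (fill w)
    fill-bound (c ∷ w) dom = bound (missing-view c)
      where
      total-bound : 4 * (1 + m * 3) + missing c ≤ 4 * ∣ fill (c ∷ w) ∣
      total-bound = subst₂ (λ x y → x + missing c ≤ 4 * y) scale (sym (∣fill∣ (c ∷ w)))
        (column-bound c w (dominating⁻ (c ∷ w) dom))

      bound : lookup c 1F ≡ true ⊎ missing c ≡ 1 → Bound (fill (c ∷ w))
      bound (inj₁ c₁)  = *-cancelˡ-≤ 4 (≤-trans (m≤m+n _ _) total-bound)
                       , inj₁ (vertex-∈-fill (c ∷ w) (1F , zero) c₁)
      bound (inj₂ one) = <⇒≤ lt , inj₂ lt
        where
        lt : 1 + m * 3 < ∣ fill (c ∷ w) ∣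
        lt = *-cancelˡ-< 4 _ _
          (≤-trans (≤-reflexive (trans (+-comm 1 _) (cong (4 * (1 + m * 3) +_) (sym one)))) total-bound)

  dominating-bound : ∀ D → Dominating G D →
                     1 + m * 3 ≤ ∣ D ∣ × (vertex (1F , zero) ∈ D ⊎ 2 + m * 3 ≤ ∣ D ∣)
  dominating-bound D dom = subst Bound (fill-columns D)
    (fill-bound (columns D) (subst (Dominating G) (sym (fill-columns D)) dom))

  swap-bound : ∀ D → SwapSet G D → 2 + m * 3 ≤ ∣ D ∣
  swap-bound D (dom , D′ , dom′ , disjoint , ∣D∣≡∣D′∣ , _)
    with proj₂ (dominating-bound D dom) | proj₂ (dominating-bound D′ dom′)
  ... | inj₂ le | _        = le
  ... | inj₁ _  | inj₂ le  = ≤-trans le (≤-reflexive (sym ∣D∣≡∣D′∣))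
  ... | inj₁ v∈ | inj₁ v∈′ = contradiction (_ , x∈p∩q⁺ (v∈ , v∈′)) disjoint

-- A minimum dominating set

module _ where
  private
    ends middle : Subset 3
    ends   = true ∷ false ∷ true ∷ []
    middle = false ∷ true ∷ false ∷ []

  alternation : ∀ m → Vec (Subset 3) (m * 4)
  alternation zero    = []
  alternation (suc m) = ⊥ ∷ ends ∷ ⊥ ∷ middle ∷ alternation m

  alternating : ∀ m → Vec (Subset 3) (1 + m * 4)
  alternating m = middle ∷ alternation m

  -- Each later `middle` is preceded by an empty column, which looks like the border; hence the
  -- remaining word is again an instance of the claim.
  alternating-dominates : ∀ m → Windows DominatedBetween ⊥ ⊥ (alternating m)
  alternating-dominates zero    = from-yes (dominatedBetween? ⊥ middle ⊥) ∷ []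
  alternating-dominates (suc m) = from-yes (dominatedBetween? ⊥ middle ⊥)
    ∷ from-yes (dominatedBetween? middle ⊥ ends)
    ∷ from-yes (dominatedBetween? ⊥ ends ⊥)
    ∷ from-yes (dominatedBetween? ends ⊥ middle)
    ∷ alternating-dominates m

  total-alternating : ∀ m → total (alternating m) ≡ 1 + m * 3
  total-alternating zero    = refl
  total-alternating (suc m) = cong (3 +_) (total-alternating m)

-- Swap sets from labelled columns

-- A move leads to the previous column, to the next column, or to a row of the same column.
Move : Set
Move = Bool ⊎ Fin 3

pattern ◀ = inj₁ false
pattern ▶ = inj₁ true

-- The move by which the partner of a cell in row `i` points back to it.
reverse : Fin 3 → Move → Move
reverse i (inj₁ d) = inj₁ (not d)
reverse i (inj₂ _) = inj₂ i

-- A cell of D (true) or D′ (false) carries the move to its partner.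
Cell : Set
Cell = Maybe (Bool × Move)

pattern D  m = just (true , m)
pattern D′ m = just (false , m)
pattern ·    = nothing

_≟ᶜ_ : (x y : Cell) → Dec (x ≡ y)
_≟ᶜ_ = Maybe.≡-dec (×-≡-dec Bool._≟_ (⊎-≡-dec Bool._≟_ Fin._≟_))

Column : Set
Column = Vec Cell 3

blank : Column
blank = replicate 3 ·

-- The target must lie in the other set and point back, which makes the matching a condition on
-- three consecutive columns. No move into a blank border column can satisfy it.
Matched : Column → Column → Column → Fin 3 → Cell → Set
Matched a b c i ·                    = ⊤
Matched a b c i (just (s , ◀))       = lookup a i ≡ just (not s , ▶)
Matched a b c i (just (s , ▶))       = lookup c i ≡ just (not s , ◀)
Matched a b c i (just (s , inj₂ i′)) = Graph.Adj (P 3) i i′ × lookup b i′ ≡ just (not s , inj₂ i)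

matched? : ∀ a b c i x → Dec (Matched a b c i x)
matched? a b c i ·                    = yes tt
matched? a b c i (just (s , ◀))       = _ ≟ᶜ _
matched? a b c i (just (s , ▶))       = _ ≟ᶜ _
matched? a b c i (just (s , inj₂ i′)) = Graph.adj? (P 3) i i′ ×-dec (_ ≟ᶜ _)

has : Bool → Cell → Bool
has s nothing        = false
has s (just (t , _)) = does (s Bool.≟ t)

has⁻ : ∀ s x → has s x ≡ true → ∃[ m ] x ≡ just (s , m)
has⁻ true  (D m)  _ = m , refl
has⁻ false (D′ m) _ = m , refl

has⁺ : ∀ s {x m} → x ≡ just (s , m) → has s x ≡ true
has⁺ true  refl = refl
has⁺ false refl = refl

side : Bool → Column → Subset 3
side s = map (has s)

Good : Column → Column → Column → Set
Good a b c = (∀ i → Matched a b c i (lookup b i))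
  × DominatedBetween (side true a) (side true b) (side true c)
  × DominatedBetween (side false a) (side false b) (side false c)

good? : ∀ a b c → Dec (Good a b c)
good? a b c = all? (λ i → matched? a b c i (lookup b i))
  ×-dec dominatedBetween? (side true a) (side true b) (side true c)
  ×-dec dominatedBetween? (side false a) (side false b) (side false c)

module _ {n : ℕ} (w : Vec Column n) (good : Windows Good blank blank w) where
  open Grid n

  private
    -- A relation rather than a function, since a move from a border column may have no target.
    Link : Move → V → V → Set
    Link ◀         (i , j) (i′ , j′) = i ≡ i′ × toℕ j ≡ suc (toℕ j′)
    Link ▶         (i , j) (i′ , j′) = i ≡ i′ × toℕ j′ ≡ suc (toℕ j)
    Link (inj₂ i₁) (i , j) (i′ , j′) = Graph.Adj (P 3) i i₁ × i₁ ≡ i′ × j ≡ j′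

    link-adj : ∀ m {v v′} → Link m v v′ → v ~ v′
    link-adj ◀        (refl , s)        = inj₁ (refl , inj₂ s)
    link-adj ▶        (refl , s)        = inj₁ (refl , inj₁ s)
    link-adj (inj₂ _) (a , refl , refl) = inj₂ (a , refl)

    link-sym : ∀ m {v v′} → Link m v v′ → Link (reverse (proj₁ v) m) v′ v
    link-sym ◀        (refl , s)        = refl , s
    link-sym ▶        (refl , s)        = refl , s
    link-sym (inj₂ _) (a , refl , refl) = Graph.symm (P 3) a , refl , refl

    link-functional : ∀ m {v v₁ v₂} → Link m v v₁ → Link m v v₂ → v₁ ≡ v₂
    link-functional ◀ (refl , s) (refl , t) =
      cong (_ ,_) (toℕ-injective (suc-injective (trans (sym s) t)))
    link-functional ▶ (refl , s) (refl , t) = cong (_ ,_) (toℕ-injective (trans s (sym t)))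
    link-functional (inj₂ _) (_ , refl , refl) (_ , refl , refl) = refl

    blank-empty : ∀ i {x} → lookup blank i ≢ just x
    blank-empty 0F ()
    blank-empty 1F ()
    blank-empty 2F ()

    partner : ∀ v s m → w at v ≡ just (s , m) →
              ∃[ v′ ] (Link m v v′ × w at v′ ≡ just (not s , reverse (proj₁ v) m))
    partner (i , j) s m eq
      with subst (Matched _ _ _ i) eq (proj₁ (window good j) i)
    partner (i , j) s ◀ eq | t with prev-view blank w j
    -- A move off the grid would need a partner in the blank border column.
    ... | inj₁ e            = contradiction (subst (λ c → lookup c i ≡ _) e t) (blank-empty i)
    ... | inj₂ (j′ , l , e) = (i , j′) , (refl , l) , subst (λ c → lookup c i ≡ _) e t
    partner (i , j) s ▶ eq | t with next-view blank w j
    ... | inj₁ e            = contradiction (subst (λ c → lookup c i ≡ _) e t) (blank-empty i)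
    ... | inj₂ (j′ , l , e) = (i , j′) , (refl , l) , subst (λ c → lookup c i ≡ _) e t
    partner (i , j) s (inj₂ i′) eq | a , t = (i′ , j) , (a , refl , refl) , t

    set : Bool → Subset (3 * n)
    set s = fill (map (side s) w)

    at-side : ∀ s v → map (side s) w at v ≡ has s (w at v)
    at-side s (i , j) = trans (cong (λ c → lookup c i) (lookup-map j (side s) w))
      (lookup-map i (has s) (lookup w j))

    ∈-set⁺ : ∀ s {x m} → w at coords x ≡ just (s , m) → x ∈ set s
    ∈-set⁺ s {x} eq = ∈-fill⁺ _ x (trans (at-side s (coords x)) (has⁺ s eq))

    ∈-set⁻ : ∀ s {x} → x ∈ set s → ∃[ m ] w at coords x ≡ just (s , m)
    ∈-set⁻ s {x} x∈ = has⁻ s _ (trans (sym (at-side s (coords x))) (∈-fill⁻ _ x x∈))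

    -- Packages a partner with its evidence, so that the facts below hold for any two such records
    -- and never unfold `mateOf`.
    record Mate (s : Bool) (x : Fin (3 * n)) : Set where
      field
        move       : Move
        mate       : Fin (3 * n)
        move-at    : w at coords x ≡ just (s , move)
        link       : Link move (coords x) (coords mate)
        reverse-at : w at coords mate ≡ just (not s , reverse (proj₁ (coords x)) move)

    mateOf : ∀ s {x} → x ∈ set s → Mate s x
    mateOf s {x} x∈ with ∈-set⁻ s x∈
    ... | m , eq with partner (coords x) s m eq
    ...   | v , l , eq′ = record
      { move       = m
      ; mate       = vertex v
      ; move-at    = eq
      ; link       = subst (Link m (coords x)) (sym (coords-vertex v)) l
      ; reverse-at = trans (cong (w at_) (coords-vertex v)) eq′
      }

    move-unique : ∀ {x : Cell} {s t m l} → x ≡ just (s , m) → x ≡ just (t , l) → m ≡ l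
    move-unique refl refl = refl

    -- A mate is reached back by the reversed move, which its cell determines.
    mate-injective : ∀ {s x y} (M : Mate s x) (N : Mate s y) → Mate.mate M ≡ Mate.mate N → x ≡ y
    mate-injective {x = x} {y} M N eq = coords-injective (link-functional _
      (link-sym _ (Mate.link M))
      (subst₂ (λ m z → Link m (coords z) (coords y))
        (move-unique (Mate.reverse-at N)
          (trans (cong (λ z → w at coords z) (sym eq)) (Mate.reverse-at M)))
        (sym eq) (link-sym _ (Mate.link N))))

    -- The mate in `M` carries the reversed move, which is the one that `N` follows; links are
    -- functional, so it leads back to `y`.
    mate-involutive : ∀ {s y} (M : Mate (not s) y) (N : Mate s (Mate.mate M)) → Mate.mate N ≡ y
    mate-involutive {y = y} M N = coords-injective (link-functional _
      (Mate.link N)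
      (subst (λ m → Link m _ (coords y))
        (move-unique (Mate.reverse-at M) (Mate.move-at N)) (link-sym _ (Mate.link M))))

    ∃∈-≡ : ∀ {p : Subset (3 * n)} {x y : ∃ (_∈ p)} → proj₁ x ≡ proj₁ y → x ≡ y
    ∃∈-≡ {x = a , p} {y = .a , q} refl = cong (a ,_) ([]=-irrelevant p q)

    to : ∃ (_∈ set true) → ∃ (_∈ set false)
    to (x , x∈) = Mate.mate M , ∈-set⁺ false (Mate.reverse-at M)
      where M = mateOf true x∈

    from : ∃ (_∈ set false) → ∃ (_∈ set true)
    from (y , y∈) = Mate.mate M , ∈-set⁺ true (Mate.reverse-at M)
      where M = mateOf false y∈

    matching : PerfectMatching G (set true) (set false)
    matching = mk⤖ {to = to}
        ( (λ {x} {y} e → ∃∈-≡ (mate-injective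
            (mateOf true (proj₂ x)) (mateOf true (proj₂ y)) (cong proj₁ e)))
        , λ y → from y , λ { refl → ∃∈-≡ (mate-involutive
            (mateOf false (proj₂ y)) (mateOf true (proj₂ (from y)))) } )
      , λ x → link-adj _ (Mate.link (mateOf true (proj₂ x)))

  swapSet : total (map (side true) w) ≡ total (map (side false) w) →
            SwapSet G (fill (map (side true) w))
  swapSet eq =
      dominating⁺ _ (windows-map (side true) (proj₁ ∘ proj₂) good)
    , set false
    , dominating⁺ _ (windows-map (side false) (proj₂ ∘ proj₂) good)
    , (λ (x , x∈) → disjoint x (x∈p∩q⁻ (set true) (set false) x∈))
    , trans (∣fill∣ _) (trans eq (sym (∣fill∣ _)))
    , matching
    where
    disjoint : ∀ x → ¬ (x ∈ set true × x ∈ set false)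
    disjoint x (x∈ , x∈′) with ∈-set⁻ true x∈ | ∈-set⁻ false x∈′
    ... | m , e | m′ , e′ with trans (sym e) e′
    ...   | ()

-- An explicit family of swap words

module _ where
  private
    c₀ c₁ c₂ c₃ c₄ c₅ c₆ c₇ d₇ d₈ : Column
    c₀ = · ∷ D′ (inj₂ 2F) ∷ D (inj₂ 1F) ∷ []
    c₁ = D ▶ ∷ · ∷ · ∷ []
    c₂ = D′ ◀ ∷ · ∷ D′ ▶ ∷ []
    c₃ = · ∷ D ▶ ∷ D ◀ ∷ []
    c₄ = · ∷ D′ ◀ ∷ · ∷ []
    c₅ = D ▶ ∷ · ∷ D ▶ ∷ []
    c₆ = D′ ◀ ∷ · ∷ D′ ◀ ∷ []
    c₇ = · ∷ D ▶ ∷ · ∷ []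
    d₇ = D′ (inj₂ 1F) ∷ D (inj₂ 0F) ∷ · ∷ []
    d₈ = · ∷ D (inj₂ 2F) ∷ D′ (inj₂ 1F) ∷ []

  -- The period `c₆`, `c₇`, `c₄`, `c₅` holds three vertices of each set, all matched horizontally.
  -- Vertical edges occur only in `c₀`, `d₇` and `d₈`, at the two ends of the word.
  swapTail : ∀ k → Vec Column (3 + k * 4)
  swapTail zero    = c₆ ∷ d₇ ∷ d₈ ∷ []
  swapTail (suc k) = c₆ ∷ c₇ ∷ c₄ ∷ c₅ ∷ swapTail k

  swapWord : ∀ k → Vec Column (9 + k * 4)
  swapWord k = c₀ ∷ c₁ ∷ c₂ ∷ c₃ ∷ c₄ ∷ c₅ ∷ swapTail k

  swapWord-good : ∀ k → Windows Good blank blank (swapWord k)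
  swapWord-good k = from-yes (good? blank c₀ c₁) ∷ from-yes (good? c₀ c₁ c₂)
    ∷ from-yes (good? c₁ c₂ c₃) ∷ from-yes (good? c₂ c₃ c₄) ∷ from-yes (good? c₃ c₄ c₅)
    ∷ good-tail k
    where
    -- Every period ends in `c₄`, `c₅`, the columns just before the tail, so the same situation
    -- recurs. Starting at `c₅` lets the case split on `k` reveal that the tail begins with `c₆`.
    good-tail : ∀ k → Windows Good c₄ blank (c₅ ∷ swapTail k)
    good-tail zero    = from-yes (good? c₄ c₅ c₆) ∷ from-yes (good? c₅ c₆ d₇)
      ∷ from-yes (good? c₆ d₇ d₈) ∷ from-yes (good? d₇ d₈ blank) ∷ []
    good-tail (suc k) = from-yes (good? c₄ c₅ c₆) ∷ from-yes (good? c₅ c₆ c₇)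
      ∷ from-yes (good? c₆ c₇ c₄) ∷ from-yes (good? c₇ c₄ c₅) ∷ good-tail k

  total-swapWord : ∀ s k → total (map (side s) (swapWord k)) ≡ 8 + k * 3
  total-swapWord true  zero    = refl
  total-swapWord false zero    = refl
  total-swapWord true  (suc k) = cong (3 +_) (total-swapWord true k)
  total-swapWord false (suc k) = cong (3 +_) (total-swapWord false k)

-- The two values for n = 4m + 1

γ-grid : ∀ m → γ (P 3 □ P (1 + m * 4)) ≡ 1 + m * 3
γ-grid m = γ≡ (P 3 □ P (1 + m * 4))
  ( (fill (alternating m) , Grid.dominating⁺ _ _ (alternating-dominates m)
    , trans (∣fill∣ (alternating m)) (total-alternating m))
  , λ p dom → proj₁ (dominating-bound m p dom) )

DDₘ-grid : ∀ m → 1 + m * 4 > 9 → DDₘ (P 3 □ P (1 + m * 4)) ≡ [ 1 + (1 + m * 3) ]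
DDₘ-grid m n>9 = DDₘ≡ (P 3 □ P (1 + m * 4)) (attained m n>9 , swap-bound m)
  where
  attained : ∀ m → 1 + m * 4 > 9 → ∃[ p ] (SwapSet (P 3 □ P (1 + m * 4)) p × ∣ p ∣ ≡ 2 + m * 3)
  -- For `m` equal to 0 or 1 the grid has 1 or 5 columns, contradicting the hypothesis. Otherwise
  -- `m = 2 + k`, and `swapWord k` has `9 + k * 4 = 1 + m * 4` columns and `8 + k * 3 = 2 + m * 3`
  -- vertices on each side.
  attained zero          (s≤s ())
  attained (suc zero)    (s≤s (s≤s (s≤s (s≤s (s≤s ())))))
  attained (suc (suc k)) _ = _
    , swapSet (swapWord k) (swapWord-good k)
        (trans (total-swapWord true k) (sym (total-swapWord false k)))
    , trans (∣fill∣ _) (total-swapWord true k)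

one-more : ∀ G {k} → γ G ≡ k → DDₘ G ≡ [ 1 + k ] → DDₘ G ≡ [ γ G + 1 ]
one-more G refl eq = trans eq (cong [_] (+-comm 1 (γ G)))

lemma30 : ∀ (n : ℕ) → n > 9 → n % 4 ≡ 1 → DDₘ (P 3 □ P n) ≡ [ γ (P 3 □ P n) + 1 ]
lemma30 n n>9 n%4≡1 = subst (λ n → DDₘ (P 3 □ P n) ≡ [ γ (P 3 □ P n) + 1 ]) (sym n≡)
  (one-more (P 3 □ P (1 + n / 4 * 4)) (γ-grid (n / 4)) (DDₘ-grid (n / 4) (subst (_> 9) n≡ n>9)))
  where
  n≡ : n ≡ 1 + n / 4 * 4
  n≡ = trans (m≡m%n+[m/n]*n n 4) (cong (_+ n / 4 * 4) n%4≡1)
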